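{- Let $\mathcal{X}=(\Omega,S)$ be a pseudo-TI scheme of valency $k$ and index $n/m$, where $n=|\Omega|$ and $m=|S_1|$. If $n/m>1+6k^2(k-1)$, then $\mathcal{X}$ is a separable TI-scheme.
   Context: A coherent configuration on a finite set $\Omega$ is a pair $\mathcal{X}=(\Omega,S)$, where $S$ is a partition of $\Omega\times\Omega$ such that: (C1) the diagonal $1_\Omega=\{(\alpha,\alpha):\alpha\in\Omega\}$ is a union of elements of $S$; (C2) for every $s\in S$, $s^*=\{(\beta,\alpha):(\alpha,\beta)\in s\}\in S$; (C3) for all $r,s,t\in S$ the number $c_{rs}^t=|\alpha r\cap\beta s^*|$ does not depend on $(\alpha,\beta)\in t$, where $\alpha r=\{\beta:(\alpha,\beta)\in r\}$. Elements of $S$ are basis relations and $c_{rs}^t$ are intersection numbers. $\mathcal{X}$ is homogeneous (a scheme) if $1_\Omega\in S$; then each $s\in S$ has valency $n_s=|\alpha s|$ (independent of $\alpha$), and $S_k=\{s\in S:n_s=k\}$. The indistinguishing number of $r\in S$ is $c(r)=\sum_{s\in S}c_{ss^*}^r$, and the indistinguishing number $c$ of $\mathcal{X}$ is the maximum of $c(r)$ over $r\in S\setminus\{1_\Omega\}$. A homogeneous coherent configuration with maximum valency $k$ is a pseudo-TI scheme of valency $k$ and index $n/m$ (with $n=|\Omega|$, $m=|S_1|$) if $S=S_1\cup S_k$ and $c\le mk$. A subgroup $H$ of a finite group $G$ is a TI-subgroup if $H^g\cap H\in\{H,1\}$ for all $g\in G$. The coherent configuration associated with a permutation group $G\le\mathrm{Sym}(\Omega)$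 is $(\Omega,S)$ with $S$ the set of orbits of $G$ on $\Omega\times\Omega$. A homogeneous coherent configuration is a TI-scheme if it is the coherent configuration associated with some transitive permutation group whose one-point stabilizer is a TI-subgroup. An algebraic isomorphism from $(\Omega,S)$ to $(\Omega',S')$ is a bijection $\varphi:S\to S'$ with $c_{rs}^t=c_{\varphi(r)\varphi(s)}^{\varphi(t)}$ for all $r,s,t\in S$. $\mathcal{X}$ is separable if for every coherent configuration $\mathcal{X}'$ and every algebraic isomorphism $\varphi:\mathcal{X}\to\mathcal{X}'$ there is a bijection $f:\Omega\to\Omega'$ with $s^f=\varphi(s)$ for all $s\in S$, where $s^f=\{(\alpha^f,\beta^f):(\alpha,\beta)\in s\}$. -}

module Defs where

open import Data.Nat using (ℕ; zero; suc; _+_; _*_; _≤_)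
open import Data.Fin using (Fin; zero; suc; _≟_)
open import Data.Bool using (Bool; true; false; if_then_else_; _∧_)
open import Data.Product using (Σ; ∃; ∃-syntax; _×_; _,_; proj₁; proj₂)
open import Data.Sum using (_⊎_)
open import Function using (_∘_; id)
open import Function.Definitions using (Injective; Bijective)
open import Relation.Nullary using (¬_)
open import Relation.Nullary.Decidable using (⌊_⌋)
open import Relation.Binary.PropositionalEquality using (_≡_; _≗_)

#_ : ∀ {n} → (Fin n → Bool) → ℕ
#_ {zero}  f = 0
#_ {suc n} f = (if f zero then 1 else 0) + #_ (f ∘ suc)

sumF : ∀ {n} → (Fin n → ℕ) → ℕ
sumF {zero}  f = 0
sumF {suc n} f = f zero + sumF (f ∘ suc)

-- A coherent configuration on Ω = Fin n whose partition S has r blocks.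
-- The partition is encoded by a labelling rel : Ω × Ω → Fin r; the basis
-- relation with label s is the fibre { (α,β) | rel α β ≡ s }.
record CC (n r : ℕ) : Set where
  field
    rel   : Fin n → Fin n → Fin r
    surj  : (t : Fin r) → Σ (Fin n × Fin n) (λ p → rel (proj₁ p) (proj₂ p) ≡ t)
    -- (C1) the diagonal is a union of basis relations
    C1    : ∀ a b c → rel a a ≡ rel b c → b ≡ c
    -- (C2) s* is a basis relation (star s is its label)
    star  : Fin r → Fin r
    C2    : ∀ a b → rel b a ≡ star (rel a b)

  cnt : Fin n → Fin n → Fin r → Fin r → ℕ
  cnt α β r s = # (λ γ → ⌊ rel α γ ≟ r ⌋ ∧ ⌊ rel β γ ≟ star s ⌋)

  field
    C3    : ∀ r s α β α' β' → rel α β ≡ rel α' β' → cnt α β r s ≡ cnt α' β' r s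

  inum : Fin r → Fin r → Fin r → ℕ
  inum r s t = cnt (proj₁ (proj₁ (surj t))) (proj₂ (proj₁ (surj t))) r s

  val : Fin n → Fin r → ℕ
  val α s = # (λ β → ⌊ rel α β ≟ s ⌋)

  indist : Fin r → ℕ
  indist t = sumF (λ s → inum s (star s) t)

open CC public

IsDiag : ∀ {n r} → CC n r → Fin r → Set
IsDiag X d = (∀ a b → rel X a b ≡ d → a ≡ b) × (∀ a → rel X a a ≡ d)

Homogeneous : ∀ {n r} → CC n r → Set
Homogeneous X = ∃[ d ] IsDiag X d

record PseudoTI {n r : ℕ} (X : CC n r) (k m : ℕ) : Set where
  field
    d       : Fin r
    diag    : IsDiag X d
    vals    : ∀ α s → val X α s ≡ 1 ⊎ val X α s ≡ k
    maxval  : ∃[ α ] ∃[ s ] val X α s ≡ k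
    mdef    : ∀ α → m ≡ # (λ s → ⌊ Data.Nat._≟_ (val X α s) 1 ⌋)
    indistB : ∀ t → ¬ (t ≡ d) → indist X t ≤ m * k

record PermGroup (n : ℕ) : Set₁ where
  field
    mem  : (Fin n → Fin n) → Set
    perm : ∀ {g} → mem g → Injective _≡_ _≡_ g
    ext  : ∀ {f g} → f ≗ g → mem f → mem g
    id∈  : mem id
    comp : ∀ {f g} → mem f → mem g → mem (f ∘ g)
    inv  : ∀ {f} → mem f → ∃[ g ] (mem g × (g ∘ f ≗ id) × (f ∘ g ≗ id))

open PermGroup public

Transitive : ∀ {n} → PermGroup n → Set
Transitive G = ∀ a b → ∃[ g ] (mem G g × g a ≡ b)

Stab : ∀ {n} → (G : PermGroup n) → Fin n → (Fin n → Fin n) → Set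
Stab G α f = mem G f × f α ≡ α

-- H ≤ G is a TI-subgroup: for every g ∈ G, H^g ∩ H = H or H^g ∩ H = 1,
-- where H^g = { g⁻¹ h g } (with x^g = g x, so g⁻¹ h g acts as g ∘ h ∘ g⁻¹).
IsTI : ∀ {n} → (G : PermGroup n) → ((Fin n → Fin n) → Set) → Set
IsTI {n} G H =
  ∀ g ginv → mem G g → mem G ginv → (ginv ∘ g ≗ id) → (g ∘ ginv ≗ id) →
    let Hg : (Fin n → Fin n) → Set
        Hg f = ∃[ h ] (H h × (f ≗ g ∘ h ∘ ginv))
    in (∀ f → H f → Hg f) ⊎ (∀ f → Hg f → H f → f ≗ id)

Associated : ∀ {n r} → CC n r → PermGroup n → Set
Associated X G = ∀ a b c e →
  (rel X a b ≡ rel X c e → ∃[ g ] (mem G g × g a ≡ c × g b ≡ e)) ×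
  (∃[ g ] (mem G g × g a ≡ c × g b ≡ e) → rel X a b ≡ rel X c e)

TIScheme : ∀ {n r} → CC n r → Set₁
TIScheme {n} X = Homogeneous X ×
  Σ (PermGroup n) (λ G → Transitive G × Associated X G × (∀ α → IsTI G (Stab G α)))

AlgIso : ∀ {n r n' r'} → CC n r → CC n' r' → (Fin r → Fin r') → Set
AlgIso X X' φ = Bijective _≡_ _≡_ φ ×
  (∀ r s t → inum X r s t ≡ inum X' (φ r) (φ s) (φ t))

Separable : ∀ {n r} → CC n r → Set
Separable {n} {r} X = ∀ n' r' (X' : CC n' r') (φ : Fin r → Fin r') → AlgIso X X' φ →
  ∃[ f ] (Bijective _≡_ _≡_ f × (∀ a b → rel X' (f a) (f b) ≡ φ (rel X a b)))

-- Fix an algebraic isomorphism φ and call pairs ab, a'b' similar if φ maps the relation of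
-- the first to that of the second. Intersection numbers only transport triangles. But if β
-- and δ are each determined by their relations to α and γ, then similarity of the pairs αγ,
-- αβ, βγ, αδ, δγ forces that of βδ: as the indistinguishing number is at most mk, all but
-- 3k²(mk) points ω give five points to which a Desargues-type argument applies. Starting
-- from a similar pair αγ of valency k, this transports all points determined by α and γ,
-- i.e. all but k(mk) of them, and then, through pairs of points already transported, every
-- point. The result is an isomorphism inducing φ and extending αγ. Separability follows at
-- once; φ = id gives the transitivity of the automorphism group on each basis relation, and
-- an automorphism fixing two points at a relation of valency k is trivial, whence TI.
module Submission where

open import Defs
open import Data.Bool using (Bool; true; false; if_then_else_; _∧_; T)
open import Data.Bool.Properties using (T-∧)
open import Data.Fin using (Fin; zero; suc; _≟_)
open import Data.Fin.Properties using (injective⇒≤; suc-injective; ¬∀⟶∃¬)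
open import Data.List using (List; []; _∷_; _++_; map; length; concatMap)
open import Data.List.Membership.Propositional using (_∈_; lose)
open import Data.List.Membership.Propositional.Properties using (∈-map⁺; ∈-++⁺ˡ; ∈-++⁺ʳ; ∈-concatMap⁺)
import Data.List.Membership.DecPropositional as DecMembership
import Data.List.Membership.Setoid.Properties as Membership
open import Data.List.Properties using (length-map; length-++)
open import Data.List.Relation.Unary.Any using (here; there; index)
open import Data.Nat using (ℕ; zero; suc; _+_; _*_; _∸_; _<_; _≤_; z≤n; s≤s; _≤?_)
open import Data.Nat.Properties hiding (_≟_; suc-injective)
open import Algebra.Properties.CommutativeSemigroup +-commutativeSemigroup using (interchange)
open import Data.Nat.Tactic.RingSolver using (solve-∀)
open import Data.Product using (Σ; ∃-syntax; _×_; _,_; proj₁; proj₂)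
open import Data.Sum using (_⊎_; inj₁; inj₂; [_,_]′)
open import Data.Unit using (tt)
open import Function using (_∘_; id; Equivalence)
open import Function.Definitions using (Bijective)
open import Relation.Nullary using (¬_; yes; no; contradiction)
open import Relation.Nullary.Decidable using (⌊_⌋; decidable-stable; toWitness; fromWitness)
open import Relation.Binary.PropositionalEquality

-- Bounding and counting finite sets

-- A covering list bounds a predicate without deciding it, and union bounds become concatenation.
Few : ∀ {n} → (Fin n → Set) → ℕ → Set
Few {n} P b = Σ (List (Fin n)) λ l → length l ≤ b × (∀ {i} → P i → i ∈ l)

module _ {n : ℕ} where

  few-⊆ : {P Q : Fin n → Set} {b : ℕ} → (∀ {i} → P i → Q i) → Few Q b → Few P b
  few-⊆ P⊆Q (l , l≤b , cover) = l , l≤b , cover ∘ P⊆Q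

  few-≤ : {P : Fin n → Set} {a b : ℕ} → a ≤ b → Few P a → Few P b
  few-≤ a≤b (l , l≤a , cover) = l , ≤-trans l≤a a≤b , cover

  few-∅ : {P : Fin n → Set} {b : ℕ} → (∀ i → ¬ P i) → Few P b
  few-∅ ¬P = [] , z≤n , λ {i} p → contradiction p (¬P i)

  few-⊎ : {P Q : Fin n → Set} {a b : ℕ} →
    Few P a → Few Q b → Few (λ i → P i ⊎ Q i) (a + b)
  few-⊎ {a = a} {b} (l , l≤a , coverP) (l' , l'≤b , coverQ) =
    l ++ l' , subst (_≤ a + b) (sym (length-++ l)) (+-mono-≤ l≤a l'≤b) ,
    [ ∈-++⁺ˡ ∘ coverP , ∈-++⁺ʳ l ∘ coverQ ]′

  few-avoid : {P : Fin n → Set} {b : ℕ} → b < n → Few P b → ∃[ i ] ¬ P i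
  few-avoid {P} {b} b<n (l , l≤b , cover) = proj₁ outside , proj₂ outside ∘ cover
    where
    open DecMembership (_≟_ {n}) using (_∈?_)
    not-all : ¬ (∀ i → i ∈ l)
    not-all all = <-irrefl refl (<-≤-trans b<n (≤-trans
      (injective⇒≤ {f = λ i → index (all i)}
        (λ eq → Membership.index-injective (setoid (Fin n)) (all _) (all _) eq)) l≤b))
    outside = ¬∀⟶∃¬ n (_∈ l) (_∈? l) not-all

length-concatMap : ∀ {n} {A : Set} (g : A → List (Fin n)) {b} →
  (∀ i → length (g i) ≤ b) → ∀ l → length (concatMap g l) ≤ length l * b
length-concatMap g {b} g≤b []      = z≤n
length-concatMap g {b} g≤b (i ∷ l) =
  subst (_≤ b + length l * b) (sym (length-++ (g i)))
    (+-mono-≤ (g≤b i) (length-concatMap g g≤b l))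

few-∃ : ∀ {n n'} {P : Fin n → Set} {Q : Fin n → Fin n' → Set} {a b : ℕ} →
  Few P a → (∀ i → Few (Q i) b) → Few (λ j → ∃[ i ] (P i × Q i j)) (a * b)
few-∃ {a = a} {b} (l , l≤a , cover) few =
  concatMap (proj₁ ∘ few) l ,
  ≤-trans (length-concatMap (proj₁ ∘ few) (λ i → proj₁ (proj₂ (few i))) l) (*-monoˡ-≤ b l≤a) ,
  λ (i , p , q) → ∈-concatMap⁺ (proj₁ ∘ few) (lose (cover p) (proj₂ (proj₂ (few i)) q))

few-∃-sum : ∀ {n r} {Q : Fin r → Fin n → Set} {b : Fin r → ℕ} →
  (∀ s → Few (Q s) (b s)) → Few (λ j → ∃[ s ] Q s j) (sumF b)
few-∃-sum {r = zero}  few = few-∅ λ _ ()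
few-∃-sum {r = suc r} few =
  few-⊆ (λ { (zero , q) → inj₁ q ; (suc s , q) → inj₂ (s , q) })
        (few-⊎ (few zero) (few-∃-sum (few ∘ suc)))

few-# : ∀ {n} (f : Fin n → Bool) → Few (T ∘ f) (# f)
few-# {zero}  f = [] , z≤n , λ { {()} }
few-# {suc n} f with f zero in eq | few-# (f ∘ suc)
... | true  | l , l≤ , cover =
  zero ∷ map suc l , s≤s (subst (_≤ _) (sym (length-map suc l)) l≤) ,
  λ { {zero} _ → here refl ; {suc i} p → there (∈-map⁺ suc (cover p)) }
... | false | l , l≤ , cover =
  map suc l , subst (_≤ _) (sym (length-map suc l)) l≤ ,
  λ { {zero} p → contradiction (subst T eq p) (λ ()) ; {suc i} p → ∈-map⁺ suc (cover p) }

#-pos : ∀ {n} (f : Fin n → Bool) a → T (f a) → 1 ≤ # f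
#-pos f zero    fa with true ← f zero = s≤s z≤n
#-pos f (suc a) fa = ≤-trans (#-pos (f ∘ suc) a fa) (m≤n+m _ _)

#-pos⁻¹ : ∀ {n} (f : Fin n → Bool) → 1 ≤ # f → ∃[ a ] T (f a)
#-pos⁻¹ {suc n} f p with f zero in eq
... | true  = zero , subst T (sym eq) tt
... | false with a , fa ← #-pos⁻¹ (f ∘ suc) p = suc a , fa

#-two : ∀ {n} (f : Fin n → Bool) a b → a ≢ b → T (f a) → T (f b) → 2 ≤ # f
#-two f zero    zero    a≢b fa fb = contradiction refl a≢b
#-two f zero    (suc b) a≢b fa fb with true ← f zero = s≤s (#-pos (f ∘ suc) b fb)
#-two f (suc a) zero    a≢b fa fb with true ← f zero = s≤s (#-pos (f ∘ suc) a fa)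
#-two f (suc a) (suc b) a≢b fa fb =
  ≤-trans (#-two (f ∘ suc) a b (a≢b ∘ cong suc) fa fb) (m≤n+m _ _)

#-two⁻¹ : ∀ {n} (f : Fin n → Bool) → 2 ≤ # f → ∀ a → ∃[ b ] (b ≢ a × T (f b))
#-two⁻¹ {suc n} f p zero =
  let b , fb = #-pos⁻¹ (f ∘ suc) (+-cancelˡ-≤ 1 _ _ (≤-trans p (+-monoˡ-≤ _ (indicator≤1 (f zero)))))
  in suc b , (λ ()) , fb
  where
  indicator≤1 : ∀ b → (if b then 1 else 0) ≤ 1
  indicator≤1 true  = ≤-refl
  indicator≤1 false = z≤n
#-two⁻¹ {suc n} f p (suc a) with f zero in eq
... | true  = zero , (λ ()) , subst T (sym eq) tt
... | false with b , b≢a , fb ← #-two⁻¹ (f ∘ suc) p a = suc b , b≢a ∘ suc-injective , fb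

#-mono : ∀ {n} (f g : Fin n → Bool) → (∀ i → T (f i) → T (g i)) → # f ≤ # g
#-mono {zero}  f g imp = z≤n
#-mono {suc n} f g imp =
  +-mono-≤ (indicator-mono (f zero) (g zero) (imp zero)) (#-mono (f ∘ suc) (g ∘ suc) (imp ∘ suc))
  where
  indicator-mono : ∀ a b → (T a → T b) → (if a then 1 else 0) ≤ (if b then 1 else 0)
  indicator-mono false b     imp = z≤n
  indicator-mono true  true  imp = ≤-refl
  indicator-mono true  false imp = contradiction (imp tt) (λ ())

-- Finite sums and double counting

sumF-mono : ∀ {n} {f g : Fin n → ℕ} → (∀ i → f i ≤ g i) → sumF f ≤ sumF g
sumF-mono {zero}  le = z≤n
sumF-mono {suc n} le = +-mono-≤ (le zero) (sumF-mono (le ∘ suc))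

sumF-0 : ∀ n → sumF {n} (λ _ → 0) ≡ 0
sumF-0 zero    = refl
sumF-0 (suc n) = sumF-0 n

sumF-+ : ∀ {n} (f g : Fin n → ℕ) → sumF (λ i → f i + g i) ≡ sumF f + sumF g
sumF-+ {zero}  f g = refl
sumF-+ {suc n} f g =
  trans (cong (f zero + g zero +_) (sumF-+ (f ∘ suc) (g ∘ suc)))
        (interchange (f zero) (g zero) (sumF (f ∘ suc)) (sumF (g ∘ suc)))

sumF-swap : ∀ {m n} (f : Fin m → Fin n → ℕ) →
  sumF (λ i → sumF (f i)) ≡ sumF (λ j → sumF (λ i → f i j))
sumF-swap {zero}  {n} f = sym (sumF-0 n)
sumF-swap {suc m} {n} f =
  trans (cong (sumF (f zero) +_) (sumF-swap (f ∘ suc)))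
        (sym (sumF-+ (f zero) (λ j → sumF (λ i → f (suc i) j))))

#-as-sumF : ∀ {n} (f : Fin n → Bool) → # f ≡ sumF (λ i → if f i then 1 else 0)
#-as-sumF {zero}  f = refl
#-as-sumF {suc n} f = cong ((if f zero then 1 else 0) +_) (#-as-sumF (f ∘ suc))

-- The pairs of `A` and `B` joined by `E` are counted by rows and by columns.
double-count : ∀ {m n} (A : Fin m → Bool) (B : Fin n → Bool) (E : Fin m → Fin n → Bool) →
  (∀ i → T (A i) → 2 ≤ # (λ j → B j ∧ E i j)) →
  (∀ j → T (B j) → # (λ i → A i ∧ E i j) ≤ 1) →
  # A + # A ≤ # B
double-count {m} {n} A B E many single = begin
  # A + # A                                  ≡⟨ cong₂ _+_ (#-as-sumF A) (#-as-sumF A) ⟩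
  sumF (ind ∘ A) + sumF (ind ∘ A)            ≡⟨ sumF-+ (ind ∘ A) (ind ∘ A) ⟨
  sumF (λ i → ind (A i) + ind (A i))         ≤⟨ sumF-mono row ⟩
  sumF (λ i → sumF (λ j → ind (e i j)))      ≡⟨ sumF-swap (λ i j → ind (e i j)) ⟩
  sumF (λ j → sumF (λ i → ind (e i j)))      ≤⟨ sumF-mono column ⟩
  sumF (ind ∘ B)                             ≡⟨ #-as-sumF B ⟨
  # B                                        ∎
  where
  open ≤-Reasoning
  ind : Bool → ℕ
  ind b = if b then 1 else 0
  e : Fin m → Fin n → Bool
  e i j = A i ∧ B j ∧ E i j
  row : ∀ i → ind (A i) + ind (A i) ≤ sumF (λ j → ind (e i j))
  row i with A i | many i
  ... | false | _  = z≤n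
  ... | true  | le = subst (2 ≤_) (#-as-sumF (λ j → B j ∧ E i j)) (le tt)
  drop-B : ∀ a b c → T (a ∧ b ∧ c) → T (a ∧ c)
  drop-B true true true _ = tt
  needs-B : ∀ a b c → T (a ∧ b ∧ c) → T b
  needs-B true true true _ = tt
  column : ∀ j → sumF (λ i → ind (e i j)) ≤ ind (B j)
  column j = subst (_≤ ind (B j)) (#-as-sumF (λ i → e i j)) bound
    where
    bound : # (λ i → e i j) ≤ ind (B j)
    bound with B j in eq
    ... | true  = ≤-trans (#-mono _ _ (λ i → drop-B (A i) true (E i j)))
                          (single j (subst T (sym eq) tt))
    ... | false = ≮⇒≥ λ pos → let i , t = #-pos⁻¹ _ pos in needs-B (A i) false (E i j) t

-- Triangles and intersection numbers

module _ {n r : ℕ} (X : CC n r) where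

  rel-swap : ∀ {a b c e} → rel X a b ≡ rel X c e → rel X b a ≡ rel X e c
  rel-swap {a} {b} {c} {e} eq = trans (C2 X a b) (trans (cong (star X) eq) (sym (C2 X c e)))

  star-involutive : ∀ s → star X (star X s) ≡ s
  star-involutive s with surj X s
  ... | (p , q) , refl = trans (cong (star X) (sym (C2 X p q))) (sym (C2 X q p))

  triangle : ∀ {s t} a b c → rel X a c ≡ s → rel X c b ≡ t →
    T (⌊ rel X a c ≟ s ⌋ ∧ ⌊ rel X b c ≟ star X t ⌋)
  triangle a b c ac cb = Equivalence.from (T-∧ {⌊ rel X a c ≟ _ ⌋})
    (fromWitness ac , fromWitness (trans (C2 X c b) (cong (star X) cb)))

  triangle⁻¹ : ∀ {s t} a b c → T (⌊ rel X a c ≟ s ⌋ ∧ ⌊ rel X b c ≟ star X t ⌋) →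
    rel X a c ≡ s × rel X c b ≡ t
  triangle⁻¹ {s} {t} a b c tri =
    let ac , bc = Equivalence.to (T-∧ {⌊ rel X a c ≟ s ⌋}) tri
    in toWitness ac ,
       trans (C2 X b c) (trans (cong (star X) (toWitness bc)) (star-involutive t))

  inum-rel : ∀ s t a b → inum X s t (rel X a b) ≡ cnt X a b s t
  inum-rel s t a b = C3 X s t _ _ a b (proj₂ (surj X (rel X a b)))

  inum-pos : ∀ a b c → 1 ≤ inum X (rel X a c) (rel X c b) (rel X a b)
  inum-pos a b c = subst (1 ≤_) (sym (inum-rel _ _ a b))
    (#-pos _ c (triangle a b c refl refl))

  inum-pos⁻¹ : ∀ {s t} a b → 1 ≤ inum X s t (rel X a b) →
    ∃[ c ] (rel X a c ≡ s × rel X c b ≡ t)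
  inum-pos⁻¹ {s} {t} a b pos =
    let c , tc = #-pos⁻¹ _ (subst (1 ≤_) (inum-rel s t a b) pos)
    in c , triangle⁻¹ a b c tc

-- Transport along an algebraic isomorphism

-- Homogeneity of X' and the compatibility of φ with * are not part of AlgIso:
-- both are read off the intersection numbers.
module AlgebraicIsomorphism {n r n' r' : ℕ} (X : CC n r) (X' : CC n' r')
  (φ : Fin r → Fin r') (iso : AlgIso X X' φ) (d : Fin r) (diag : IsDiag X d) where

  φ-injective : ∀ {s t} → φ s ≡ φ t → s ≡ t
  φ-injective = proj₁ (proj₁ iso)

  φ-surjective : ∀ s' → ∃[ s ] φ s ≡ s'
  φ-surjective s' = let s , eq = proj₂ (proj₁ iso) s' in s , eq refl

  Sim : Fin n → Fin n → Fin n' → Fin n' → Set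
  Sim a b a' b' = rel X' a' b' ≡ φ (rel X a b)

  lift : ∀ {a b a' b'} → Sim a b a' b' → ∀ c → ∃[ c' ] (Sim a c a' c' × Sim c b c' b')
  lift {a} {b} {a'} {b'} sim c = inum-pos⁻¹ X' a' b'
    (subst (λ t → 1 ≤ inum X' (φ (rel X a c)) (φ (rel X c b)) t) (sym sim)
      (subst (1 ≤_) (proj₂ iso _ _ _) (inum-pos X a b c)))

  lower : ∀ {a b a' b'} → Sim a b a' b' → ∀ c' → ∃[ c ] (Sim a c a' c' × Sim c b c' b')
  lower {a} {b} {a'} {b'} sim c' =
    let s , φs = φ-surjective (rel X' a' c')
        t , φt = φ-surjective (rel X' c' b')
        pos : 1 ≤ inum X' (φ s) (φ t) (φ (rel X a b))
        pos = subst₂ (λ u v → 1 ≤ inum X' u v (φ (rel X a b))) (sym φs) (sym φt)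
          (subst (λ w → 1 ≤ inum X' (rel X' a' c') (rel X' c' b') w) sim (inum-pos X' a' b' c'))
        c , ac , cb = inum-pos⁻¹ X a b (subst (1 ≤_) (sym (proj₂ iso s t (rel X a b))) pos)
    in c , trans (sym φs) (cong φ (sym ac)) , trans (sym φt) (cong φ (sym cb))

  -- If the label of `a' a'` comes from a pair `p q`, the degenerate triangle `p p q` lifts to
  -- `a' c' a'`. By `C1`, `c'` is `a'`, so that label is `φ` of the label of `p p`.
  φ-diag : ∀ a' → rel X' a' a' ≡ φ d
  φ-diag a' =
    let t , φt = φ-surjective (rel X' a' a')
        (p , q) , pq = surj X t
        sim : Sim p q a' a'
        sim = trans (sym φt) (cong φ (sym pq))
        c' , pp , pq' = lift sim p
        c'≡a' = C1 X' a' c' a' (trans sim (sym pq'))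
    in trans (subst (λ x → rel X' a' x ≡ φ (rel X p p)) c'≡a' pp) (cong φ (proj₂ diag p))

  sim-refl : ∀ a a' → Sim a a a' a'
  sim-refl a a' = trans (φ-diag a') (cong φ (sym (proj₂ diag a)))

  sim-diag : ∀ {a a' b'} → Sim a a a' b' → a' ≡ b'
  sim-diag {a} {a'} {b'} sim = C1 X' a' a' b' (trans (sim-refl a a') (sym sim))

  -- The degenerate triangle `a b a` lifts to `a' c' a'`. Since `a' c'` and `a' b'` share a label,
  -- so do their reversals.
  sim-sym : ∀ {a b a' b'} → Sim a b a' b' → Sim b a b' a'
  sim-sym {a} {b} {a'} {b'} sim =
    let c' , ab , ba = lift (sim-refl a a') b
    in subst (λ s → s ≡ φ (rel X b a)) (rel-swap X' (trans ab (sym sim))) ba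

-- Points not determined by two others

module PseudoTIScheme {n r : ℕ} (X : CC n r) {k m : ℕ} (P : PseudoTI X k m) where

  open PseudoTI P

  vals-≤ : 1 ≤ k → ∀ α s → val X α s ≤ k
  vals-≤ 1≤k α s = [ (λ eq → subst (_≤ k) (sym eq) 1≤k) , ≤-reflexive ]′ (vals α s)

  few-val : ∀ α s → Few (λ β → rel X α β ≡ s) (val X α s)
  few-val α s = few-⊆ fromWitness (few-# (λ β → ⌊ rel X α β ≟ s ⌋))

  val-pos : ∀ α β → 1 ≤ val X α (rel X α β)
  val-pos α β = #-pos _ β (fromWitness refl)

  thin-unique : ∀ {α β γ} → val X α (rel X α β) ≡ 1 → rel X α γ ≡ rel X α β → γ ≡ β
  thin-unique {α} {β} {γ} val≡1 eq with γ ≟ β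
  ... | yes γ≡β = γ≡β
  ... | no  γ≢β = contradiction
    (subst (2 ≤_) val≡1 (#-two (λ δ → ⌊ rel X α δ ≟ rel X α β ⌋) γ β γ≢β (fromWitness eq) (fromWitness refl)))
    λ { (s≤s ()) }

  few-thin : ∀ α → Few (λ β → val X α (rel X α β) ≡ 1) m
  few-thin α = few-≤ (≤-reflexive (*-identityʳ m))
    -- `few-∃` asks for a bound at every label, so thinness is repeated in the second predicate.
    (few-⊆ (λ {β} eq → rel X α β , fromWitness eq , eq , refl)
      (few-∃ (few-≤ (≤-reflexive (sym (mdef α))) (few-# _)) one))
    where
    one : ∀ s → Few (λ β → val X α s ≡ 1 × rel X α β ≡ s) 1
    one s with val X α s Data.Nat.≟ 1
    ... | yes eq = few-⊆ proj₂ (few-≤ (≤-reflexive eq) (few-val α s))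
    ... | no neq = few-∅ λ _ (eq , _) → neq eq

  -- The bound on the indistinguishing number enters here: `indist` sums, over `s`, the number of
  -- points to which both `a` and `b` are joined by `s`.
  few-indistinguishable : ∀ a b → Few (λ ω → a ≢ b × rel X a ω ≡ rel X b ω) (m * k)
  few-indistinguishable a b with a ≟ b
  ... | yes a≡b = few-∅ λ _ (a≢b , _) → a≢b a≡b
  ... | no  a≢b =
    few-≤ (indistB (rel X a b) (a≢b ∘ proj₁ diag a b))
      (few-⊆ (λ {ω} (_ , eq) → rel X a ω , refl , sym eq) (few-∃-sum few))
    where
    few : ∀ s → Few (λ ω → rel X a ω ≡ s × rel X b ω ≡ s) (inum X s (star X s) (rel X a b))
    few s = few-≤ (≤-reflexive (sym (inum-rel X s (star X s) a b)))
      (few-⊆ (λ {ω} (aω , bω) → triangle X a b ω aω (trans (C2 X b ω) (cong (star X) bω)))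
             (few-# _))

  -- Failure of `μ` and `ν` to determine `β`, bracketed for `few-∃`: first a rival among the
  -- neighbours of `μ`, then its indistinguishability from `β`.
  Amb : Fin n → Fin n → Fin n → Set
  Amb μ ν β = ∃[ β₁ ] (rel X μ β₁ ≡ rel X μ β × (β₁ ≢ β × rel X β₁ ν ≡ rel X β ν))

  ¬amb-unique : ∀ {μ ν β β₁} → ¬ Amb μ ν β →
    rel X μ β₁ ≡ rel X μ β → rel X β₁ ν ≡ rel X β ν → β₁ ≡ β
  ¬amb-unique {β = β} {β₁} ¬amb μβ βν with β₁ ≟ β
  ... | yes eq = eq
  ... | no neq = contradiction (β₁ , μβ , neq , βν) ¬amb

  few-amb-right : 1 ≤ k → ∀ μ β → Few (λ ν → Amb μ ν β) (k * (m * k))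
  few-amb-right 1≤k μ β =
    few-∃ (few-≤ (vals-≤ 1≤k μ _) (few-val μ (rel X μ β))) (λ β₁ → few-indistinguishable β₁ β)

  -- The relation from ν to β joins each point of the neighbourhood of ν (k points) to at
  -- least two points of that of β (at most k points), so some point of the latter has at
  -- least two neighbours, and by C3 so has β itself.
  amb-swap : 1 ≤ k → ∀ {μ ν β} → val X μ (rel X μ ν) ≡ k → Amb μ ν β → Amb μ β ν
  amb-swap 1≤k {μ} {ν} {β} val≡k (β₁ , μβ₁ , β₁≢β , β₁ν)
    with 2 ≤? cnt X μ β (rel X μ ν) (rel X ν β)
  ... | yes two =
    let ν₁ , ν₁≢ν , t = #-two⁻¹ _ two ν
        μν₁ , ν₁β = triangle⁻¹ X μ β ν₁ t
    in ν₁ , μν₁ , ν₁≢ν , ν₁β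
  ... | no ¬two = contradiction
      (≤-trans (double-count A B E many single) (vals-≤ 1≤k μ _))
      (<⇒≱ (subst (λ v → k < v + v) (sym val≡k) (m<m+n k 1≤k)))
    where
    A B : Fin n → Bool
    A γ = ⌊ rel X μ γ ≟ rel X μ ν ⌋
    B δ = ⌊ rel X μ δ ≟ rel X μ β ⌋
    E : Fin n → Fin n → Bool
    -- In this form the count in `many` is literally `cnt X μ γ (rel X μ β) (rel X β ν)`.
    E γ δ = ⌊ rel X γ δ ≟ star X (rel X β ν) ⌋
    many : ∀ γ → T (A γ) → 2 ≤ # (λ δ → B δ ∧ E γ δ)
    many γ μγ = subst (2 ≤_)
      (C3 X (rel X μ β) (rel X β ν) μ ν μ γ (sym (toWitness μγ)))
      (#-two _ β₁ β β₁≢β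
        (triangle X μ ν β₁ μβ₁ β₁ν) (triangle X μ ν β refl refl))
    single : ∀ δ → T (B δ) → # (λ γ → A γ ∧ E γ δ) ≤ 1
    single δ μδ = ≤-trans (#-mono _ _ reverse)
      (≤-trans (≤-reflexive (C3 X (rel X μ ν) (rel X ν β) μ δ μ β (toWitness μδ)))
               (≤-pred (≰⇒> ¬two)))
      where
      reverse : ∀ γ → T (A γ ∧ E γ δ) →
        T (⌊ rel X μ γ ≟ rel X μ ν ⌋ ∧ ⌊ rel X δ γ ≟ star X (rel X ν β) ⌋)
      reverse γ t = let μγ , γδ = Equivalence.to (T-∧ {A γ}) t in
        triangle X μ δ γ (toWitness μγ) (trans (toWitness γδ) (sym (C2 X β ν)))

  -- `few-amb-right` counts reference points `ν`; exchanging roles by `amb-swap` makes it count the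
  -- ambiguous points.
  few-amb : 1 ≤ k → ∀ {μ ν} → val X μ (rel X μ ν) ≡ k → Few (Amb μ ν) (k * (m * k))
  few-amb 1≤k {μ} {ν} val≡k = few-⊆ (amb-swap 1≤k val≡k) (few-amb-right 1≤k μ ν)

  nonthin : m < n → ∀ α → ∃[ β ] val X α (rel X α β) ≡ k × 2 ≤ k
  nonthin m<n α =
    let β , val≢1 = few-avoid m<n (few-thin α)
        val≡k = [ (λ eq → contradiction eq val≢1) , id ]′ (vals α (rel X α β))
    in β , val≡k , subst (2 ≤_) val≡k (≤∧≢⇒< (val-pos α β) (val≢1 ∘ sym))

-- Extending similar pairs when the index is large

module LargeIndex {n r : ℕ} (X : CC n r) {k m : ℕ} (P : PseudoTI X k m)
  (hyp : m * (1 + 6 * (k * k) * (k ∸ 1)) < n) where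

  open PseudoTI P using (d; diag; vals)
  open PseudoTIScheme X P

  private
    q Q : ℕ
    q = k * (m * k)
    Q = k * q

  m<n : m < n
  m<n = ≤-<-trans (≤-trans (≤-reflexive (sym (*-identityʳ m))) (*-monoʳ-≤ m (s≤s z≤n))) hyp

  some-point : Fin n
  some-point = proj₁ (few-avoid {P = λ i → i ≢ i} (≤-<-trans z≤n m<n) (few-∅ λ _ neq → neq refl))

  2≤k : 2 ≤ k
  2≤k = proj₂ (proj₂ (nonthin m<n some-point))

  1≤k : 1 ≤ k
  1≤k = ≤-trans (s≤s z≤n) 2≤k

  2q≤Q : q + q ≤ Q
  2q≤Q = ≤-trans (≤-reflexive (cong (q +_) (sym (+-identityʳ q)))) (*-monoˡ-≤ q 2≤k)

  -- The constant of the hypothesis is spent here: k is at most 2(k - 1), so 3mk³ is at most 6mk²(k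
  -- - 1). The last summand on the left of `regroup` is the exact gap.
  m+3Q<n : m + (Q + (Q + Q)) < n
  m+3Q<n = ≤-<-trans (bound k 2≤k) hyp
    where
    regroup : ∀ m j → let k = 2 + j in
      m + (k * (k * (m * k)) + (k * (k * (m * k)) + k * (k * (m * k)))) + 3 * m * (k * k) * j
        ≡ m * (1 + 6 * (k * k) * (1 + j))
    regroup = solve-∀
    bound : ∀ k → 2 ≤ k →
      m + (k * (k * (m * k)) + (k * (k * (m * k)) + k * (k * (m * k))))
        ≤ m * (1 + 6 * (k * k) * (k ∸ 1))
    bound (suc zero)    (s≤s ())
    bound (suc (suc j)) _ = ≤-trans (m≤m+n _ _) (≤-reflexive (regroup m j))

  3Q<n : Q + (Q + Q) < n
  3Q<n = ≤-<-trans (m≤n+m _ m) m+3Q<n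

  5q<n : (q + q) + (q + (q + q)) < n
  5q<n = ≤-<-trans
    (+-mono-≤ 2q≤Q (+-mono-≤ (≤-trans (m≤m+n q q) 2q≤Q) 2q≤Q)) 3Q<n

  m+2q<n : m + (q + q) < n
  m+2q<n = ≤-<-trans (+-monoʳ-≤ m (≤-trans 2q≤Q (m≤m+n _ _))) m+3Q<n

  3q<n : q + (q + q) < n
  3q<n = ≤-<-trans (m≤n+m (q + (q + q)) (q + q)) 5q<n

  2q<n : q + q < n
  2q<n = ≤-<-trans (m≤n+m _ q) 3q<n

  q<n : q < n
  q<n = ≤-<-trans (m≤m+n _ _) 2q<n

  Q<n : Q < n
  Q<n = ≤-<-trans (m≤m+n _ _) 3Q<n

  few-rel : ∀ α s → Few (λ β → rel X α β ≡ s) k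
  few-rel α s = few-≤ (vals-≤ 1≤k α s) (few-val α s)

  module Extension {n' r' : ℕ} (X' : CC n' r') (φ : Fin r → Fin r') (iso : AlgIso X X' φ) where

    open AlgebraicIsomorphism X X' φ iso d diag

    sim-≡ : ∀ {a b c e a' b'} → Sim a b a' b' → Sim c e a' b' → rel X a b ≡ rel X c e
    sim-≡ ab ce = φ-injective (trans (sym ab) ce)

    -- Desargues' theorem for the five points α, β, γ, δ, ω: for generic ω the relations
    -- βω and δω are forced by those of α and γ, and then βδ is forced by those of α and ω.
    desargues : ∀ {α β γ δ α' β' γ' δ'} → ¬ Amb α γ β → ¬ Amb α γ δ →
      Sim α γ α' γ' → Sim α β α' β' → Sim β γ β' γ' → Sim α δ α' δ' → Sim δ γ δ' γ' →
      Sim β δ β' δ'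
    desargues {α} {β} {γ} {δ} {α'} {β'} {γ'} {δ'} ¬ambβ ¬ambδ αγ αβ βγ αδ δγ =
      let ω , generic = few-avoid 3Q<n (few-⊎ (few-Bad₁ β) (few-⊎ (few-Bad₁ δ) few-Bad₂))
          ω' , αω , ωγ = lift αγ ω
          γω = sim-sym ωγ
          βω = to-ω ¬ambβ (generic ∘ inj₁) αβ βγ αω γω
          δω = to-ω ¬ambδ (generic ∘ inj₂ ∘ inj₁) αδ δγ αω γω
          -- The label of `β` to `δ₂` is not yet known, but it is that of `β` to some `δ₁`, one of
          -- at most `k` points related to `α` as `δ` is. So few `ω` admit a `δ₂` other than `δ`.
          δ₁ , βδ₁ , δ₁α = lower (sim-sym αβ) δ'
          δ₂ , βδ₂ , δ₂ω = lower βω δ'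
          αδ₁ = sim-≡ (sim-sym δ₁α) αδ
          δ₂≡δ = unless λ δ₂≢δ → generic (inj₂ (inj₂
                   (δ₁ , αδ₁ , δ₂ , sim-≡ βδ₂ βδ₁ , δ₂≢δ , sim-≡ δ₂ω δω)))
      in subst (λ x → Sim β x β' δ') δ₂≡δ βδ₂
      where
      Bad₁ : Fin n → Fin n → Set
      Bad₁ ε ω = ∃[ ε₁ ] (rel X α ε₁ ≡ rel X α ε ×
                 ∃[ ε₂ ] (rel X γ ε₂ ≡ rel X γ ε × (ε₁ ≢ ε₂ × rel X ε₁ ω ≡ rel X ε₂ ω)))

      Bad₂ : Fin n → Set
      Bad₂ ω = ∃[ δ₁ ] (rel X α δ₁ ≡ rel X α δ ×
               ∃[ δ₂ ] (rel X β δ₂ ≡ rel X β δ₁ × (δ₂ ≢ δ × rel X δ₂ ω ≡ rel X δ ω)))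

      few-Bad₁ : ∀ ε → Few (Bad₁ ε) Q
      few-Bad₁ ε = few-∃ (few-rel α _) λ ε₁ → few-∃ (few-rel γ _) λ ε₂ → few-indistinguishable ε₁ ε₂

      few-Bad₂ : Few Bad₂ Q
      few-Bad₂ = few-∃ (few-rel α _) λ δ₁ → few-∃ (few-rel β _) λ δ₂ → few-indistinguishable δ₂ δ

      unless : ∀ {a b : Fin n} → ¬ (a ≢ b) → a ≡ b
      unless {a} {b} = decidable-stable (a ≟ b)

      -- Pulling `ε'` back along `αω` and along `γω` gives two points with the same relation to `ω`.
      -- Generic `ω` makes them equal, and the common point then has the relations of `ε` to both
      -- `α` and `γ`.
      to-ω : ∀ {ε ε' ω ω'} → ¬ Amb α γ ε → ¬ Bad₁ ε ω → Sim α ε α' ε' → Sim ε γ ε' γ' →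
        Sim α ω α' ω' → Sim γ ω γ' ω' → Sim ε ω ε' ω'
      to-ω {ε} {ε'} {ω} {ω'} ¬amb ¬bad αε εγ αω γω =
        let ε₁ , αε₁ , ε₁ω = lower αω ε'
            ε₂ , γε₂ , ε₂ω = lower γω ε'
            ε₁≡ε₂ = unless λ ε₁≢ε₂ → ¬bad
              (ε₁ , sim-≡ αε₁ αε , ε₂ , sim-≡ γε₂ (sim-sym εγ) , ε₁≢ε₂ , sim-≡ ε₁ω ε₂ω)
            ε₁γ = subst (λ x → Sim x γ ε' γ') (sym ε₁≡ε₂) (sim-sym γε₂)
            ε₁≡ε = ¬amb-unique ¬amb (sim-≡ αε₁ αε) (sim-≡ ε₁γ εγ)
        in subst (λ x → Sim x ω ε' ω') ε₁≡ε ε₁ω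

    module _ {α γ : Fin n} {α' γ' : Fin n'} (thick : val X α (rel X α γ) ≡ k)
      (αγ : Sim α γ α' γ') where

      private
        -- At points of `Amb α γ` the value is an arbitrary choice; `f₀-sim` vouches only for the
        -- others.
        f₀ : Fin n → Fin n'
        f₀ β = proj₁ (lift αγ β)

      f₀-sim : ∀ {β δ} → ¬ Amb α γ β → ¬ Amb α γ δ → Sim β δ (f₀ β) (f₀ δ)
      f₀-sim {β} {δ} ¬ambβ ¬ambδ =
        let _ , αβ , βγ = lift αγ β
            _ , αδ , δγ = lift αγ δ
        in desargues ¬ambβ ¬ambδ αγ αβ βγ αδ δγ

      -- Makes `β'` the right image of `β` as judged by almost all points where `f₀` is reliable.
      -- The exceptional set varies with `β`, hence is part of the data.
      Near : Fin n → Fin n' → Set₁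
      Near β β' = Σ (Fin n → Set) λ E → Few E q ×
        (∀ π → ¬ Amb α γ π → ¬ E π → Sim β π β' (f₀ π))

      near-α : Near α α'
      near-α = (λ i → i ≢ i) , few-∅ (λ _ neq → neq refl) , λ π _ _ → proj₁ (proj₂ (lift αγ π))

      near-γ : Near γ γ'
      near-γ = (λ i → i ≢ i) , few-∅ (λ _ neq → neq refl) ,
        λ π _ _ → sim-sym (proj₂ (proj₂ (lift αγ π)))

      -- Choose `μ` and `ν` with reliable images, at a relation of valency `k`, and determining `β`.
      -- They determine all but `q` points `π`, and `desargues` compares `β` with those.
      near-exists : ∀ β → Σ (Fin n') (Near β)
      near-exists β =
        let μ , ¬μ = few-avoid q<n (few-amb 1≤k thick)
            ν , ¬ν = few-avoid m+2q<n (few-⊎ (few-thin μ)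
                       (few-⊎ (few-amb 1≤k thick) (few-amb-right 1≤k μ β)))
            μν-thick = [ (λ eq → contradiction (inj₁ eq) ¬ν) , id ]′ (vals μ (rel X μ ν))
            μν = f₀-sim ¬μ (¬ν ∘ inj₂ ∘ inj₁)
            β' , μβ , βν = lift μν β
        in β' , Amb μ ν , few-amb 1≤k μν-thick , λ π ¬ambπ ¬Eπ →
             desargues (¬ν ∘ inj₂ ∘ inj₂) ¬Eπ μν μβ βν
               (f₀-sim ¬μ ¬ambπ) (f₀-sim ¬ambπ (¬ν ∘ inj₂ ∘ inj₁))

      -- One generic pair `π`, `τ` determines both `β` and `δ` and avoids both exceptional sets, so
      -- `desargues` applies.
      near-sim : ∀ {β δ β' δ'} → Near β β' → Near δ δ' → Sim β δ β' δ'
      near-sim {β} {δ} (E , fewE , βπ) (F , fewF , δπ) =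
        let few-outside = few-⊎ (few-amb 1≤k thick) (few-⊎ fewE fewF)
            π , ¬π = few-avoid 3q<n few-outside
            τ , ¬τ = few-avoid 5q<n (few-⊎ (few-⊎ (few-amb-right 1≤k π β) (few-amb-right 1≤k π δ))
                       few-outside)
        in desargues (¬τ ∘ inj₁ ∘ inj₁) (¬τ ∘ inj₁ ∘ inj₂)
             (f₀-sim (¬π ∘ inj₁) (¬τ ∘ inj₂ ∘ inj₁))
             (sim-sym (βπ π (¬π ∘ inj₁) (¬π ∘ inj₂ ∘ inj₁)))
             (βπ τ (¬τ ∘ inj₂ ∘ inj₁) (¬τ ∘ inj₂ ∘ inj₂ ∘ inj₁))
             (sim-sym (δπ π (¬π ∘ inj₁) (¬π ∘ inj₂ ∘ inj₂)))
             (δπ τ (¬τ ∘ inj₂ ∘ inj₁) (¬τ ∘ inj₂ ∘ inj₂ ∘ inj₂))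

      extension : ∃[ f ] (Bijective _≡_ _≡_ f × (∀ a b → Sim a b (f a) (f b)) ×
        f α ≡ α' × f γ ≡ γ')
      extension = f , (injective , surjective) , f-sim ,
        -- `α'` is another candidate for the image of `α`, and `near-sim` makes any two candidates
        -- equal.
        sim-diag (near-sim (f-near α) near-α) , sim-diag (near-sim (f-near γ) near-γ)
        where
        f : Fin n → Fin n'
        f β = proj₁ (near-exists β)
        f-near : ∀ β → Near β (f β)
        f-near β = proj₂ (near-exists β)
        f-sim : ∀ a b → Sim a b (f a) (f b)
        f-sim a b = near-sim (f-near a) (f-near b)
        injective : ∀ {a b} → f a ≡ f b → a ≡ b
        injective {a} {b} eq = proj₁ diag a b
          (trans (sim-≡ (f-sim a b) (subst (Sim a a (f a)) eq (sim-refl a (f a)))) (proj₂ diag a))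
        surjective : ∀ δ' → ∃[ δ ] (∀ {z} → z ≡ δ → f z ≡ δ')
        surjective δ' =
          let ε = some-point
              s , φs = φ-surjective (rel X' (f ε) δ')
              -- `δ` will depend on `τ`, but lies among the at most `k` points in relation `s` to
              -- `ε`; this `τ` serves all of them.
              τ , ¬τ = few-avoid Q<n (few-∃ (few-rel ε s) (few-amb-right 1≤k ε))
              δ , εδ , δτ = lower (f-sim ε τ) δ'
              ¬amb = λ amb → ¬τ (δ , φ-injective (trans (sym εδ) (sym φs)) , amb)
          -- With `δ` in both roles and images `δ'` and `f δ`, the conclusion concerns a diagonal
          -- pair.
          in δ , λ { refl → sym (sim-diag (desargues ¬amb ¬amb (f-sim ε τ) εδ δτ
               (f-sim ε δ) (f-sim δ τ))) }

  -- The automorphism group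

  IsAut : (Fin n → Fin n) → Set
  IsAut f = (∀ a b → rel X (f a) (f b) ≡ rel X a b) × ∃[ g ] (g ∘ f ≗ id × f ∘ g ≗ id)

  -- A fixed pair fixes every point it determines: first `π` and `τ` through `α` and `γ`, then `β`
  -- through `π` and `τ`.
  aut-fixes : ∀ {g α γ} → IsAut g → g α ≡ α → g γ ≡ γ → val X α (rel X α γ) ≡ k → g ≗ id
  aut-fixes {g} {α} {γ} (g-rel , _) gα gγ thick β =
    let π , ¬π = few-avoid q<n (few-amb 1≤k thick)
        τ , ¬τ = few-avoid 2q<n (few-⊎ (few-amb 1≤k thick) (few-amb-right 1≤k π β))
    in fixes (fixes gα gγ ¬π) (fixes gα gγ (¬τ ∘ inj₁)) (¬τ ∘ inj₂)
    where
    fixes : ∀ {a c b} → g a ≡ a → g c ≡ c → ¬ Amb a c b → g b ≡ b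
    fixes {a} {c} {b} ga gc ¬amb = ¬amb-unique ¬amb
      (subst (λ x → rel X x (g b) ≡ rel X a b) ga (g-rel a b))
      (subst (λ x → rel X (g b) x ≡ rel X b c) gc (g-rel b c))

  aut-thin : ∀ {g α γ} → IsAut g → g α ≡ α → val X α (rel X α γ) ≡ 1 → g γ ≡ γ
  aut-thin {g} {α} {γ} (g-rel , _) gα thin =
    thin-unique thin (subst (λ x → rel X x (g γ) ≡ rel X α γ) gα (g-rel α γ))

  Aut : PermGroup n
  Aut = record
    { mem  = IsAut
    ; perm = λ (_ , g , gf , _) {a} {b} eq → trans (sym (gf a)) (trans (cong g eq) (gf b))
    ; ext  = λ f≗h (f-rel , g , gf , fg) →
        (λ a b → subst₂ (λ x y → rel X x y ≡ rel X a b) (f≗h a) (f≗h b) (f-rel a b)) ,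
        g , (λ a → trans (cong g (sym (f≗h a))) (gf a)) , (λ a → trans (sym (f≗h (g a))) (fg a))
    ; id∈  = (λ _ _ → refl) , id , (λ _ → refl) , (λ _ → refl)
    ; comp = λ {f} {h} (f-rel , f⁻¹ , ff , ff') (h-rel , h⁻¹ , hh , hh') →
        (λ a b → trans (f-rel (h a) (h b)) (h-rel a b)) ,
        h⁻¹ ∘ f⁻¹ , (λ a → trans (cong h⁻¹ (ff (h a))) (hh a)) ,
        (λ a → trans (cong f (hh' (f⁻¹ a))) (ff' a))
    ; inv  = λ {f} (f-rel , g , gf , fg) →
        g ,
        ((λ a b → trans (sym (f-rel (g a) (g b))) (cong₂ (rel X) (fg a) (fg b))) , f , fg , gf) ,
        gf , fg
    }

  id-iso : AlgIso X X id
  id-iso = (id , λ y → y , id) , λ _ _ _ → refl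

  aut-thick : ∀ {a b c e} → val X a (rel X a b) ≡ k → rel X c e ≡ rel X a b →
    ∃[ g ] (IsAut g × g a ≡ c × g b ≡ e)
  aut-thick {a} {b} {c} {e} thick eq = to-aut (Extension.extension X id id-iso thick eq)
    where
    to-aut : ∃[ f ] (Bijective _≡_ _≡_ f × (∀ a b → rel X (f a) (f b) ≡ rel X a b) ×
      f a ≡ c × f b ≡ e) → ∃[ g ] (IsAut g × g a ≡ c × g b ≡ e)
    to-aut (f , (inj , onto) , f-rel , fa , fb) =
      f , (f-rel , proj₁ ∘ onto , (λ x → inj (proj₂ (onto (f x)) refl)) ,
           (λ y → proj₂ (onto y) refl)) ,
      fa , fb

  transitive : Transitive Aut
  transitive a c =
    let open AlgebraicIsomorphism X X id id-iso d diag
        b , thick , _ = nonthin m<n a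
        e , ce , _ = lift (sim-refl a c) b
        g , aut , ga , _ = aut-thick thick ce
    in g , aut , ga

  associated : Associated X Aut
  associated a b c e = to , λ { (g , (g-rel , _) , refl , refl) → sym (g-rel a b) }
    where
    to : rel X a b ≡ rel X c e → ∃[ g ] (IsAut g × g a ≡ c × g b ≡ e)
    to eq with vals a (rel X a b)
    ... | inj₂ thick = aut-thick thick (sym eq)
    ... | inj₁ thin  =
      -- Once `a` is moved to `c`, the point `g⁻¹ e` stands to `a` in the thin relation of `b`,
      -- hence is `b`.
      let g , aut@(g-rel , g⁻¹ , _ , gg) , ga = transitive a c
          g⁻¹e≡b = thin-unique thin (trans (sym (g-rel a (g⁻¹ e)))
            (trans (cong₂ (rel X) ga (gg e)) (sym eq)))
      in g , aut , ga , trans (cong g (sym g⁻¹e≡b)) (gg e)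

  -- If `α` and `g α` are at a thin relation, whatever fixes `α` fixes `g α`. Otherwise an element
  -- of both stabilizers fixes two points at valency `k`.
  stab-TI : ∀ α → IsTI Aut (Stab Aut α)
  stab-TI α g g⁻¹ g∈ g⁻¹∈ g⁻¹g gg⁻¹ with vals α (rel X α (g α))
  ... | inj₁ thin  = inj₁ λ f (f∈ , fα) →
    g⁻¹ ∘ f ∘ g ,
    (comp Aut {g⁻¹} g⁻¹∈ (comp Aut {f} {g} f∈ g∈) ,
     trans (cong g⁻¹ (aut-thin f∈ fα thin)) (g⁻¹g α)) ,
    λ a → sym (trans (gg⁻¹ (f (g (g⁻¹ a)))) (cong f (gg⁻¹ a)))
  ... | inj₂ thick = inj₂ λ f (h , (_ , hα) , f≗) (f∈ , fα) →
    aut-fixes f∈ fα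
      (trans (f≗ (g α)) (cong g (trans (cong h (g⁻¹g α)) hα))) thick

  separable : Separable X
  separable n' r' X' φ iso =
    let open AlgebraicIsomorphism X X' φ iso d diag
        α = some-point
        γ , thick , _ = nonthin m<n α
        -- Any base point will do; this one shows that `X'` has points at all.
        (α' , _) , _ = surj X' (φ d)
        γ' , αγ , _ = lift (sim-refl α α') γ
        f , f-bij , f-sim , _ = Extension.extension X' φ iso thick αγ
    in f , f-bij , f-sim

theorem1p2 : ∀ n r (X : CC n r) (k m : ℕ) → PseudoTI X k m →
    m * (1 + 6 * (k * k) * (k ∸ 1)) < n →
    TIScheme X × Separable X
theorem1p2 n r X k m P hyp =
  ((PseudoTI.d P , PseudoTI.diag P) , Aut , transitive , associated , stab-TI) , separable
  where open LargeIndex X P hyp
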